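{- Assume $\mathsf{AD}^{\mathsf{L}}$. For every $A,B\subseteq\omega^\omega$, $$A<_{\mathsf{c}}B\iff A<_{\mathsf{L}}B.$$ In particular, further assuming $\mathsf{BP}$, the preorder $\leq_{\mathsf{c}}$ is well-founded.
   Context: Base theory: $\mathsf{ZF}+\mathsf{DC}(\mathbb{R})$. $\omega^\omega$ is the Baire space with the standard metric $d(x,y)=0$ if $x=y$ and $d(x,y)=2^{ -n}$ if $x\neq y$ and $n$ is least with $x(n)\neq y(n)$. A function $f:\omega^\omega\to\omega^\omega$ is a contraction if there is a constant $0\leq L<1$ with $d(f(x),f(y))\leq L\cdot d(x,y)$ for all $x,y$, and is nonexpansive if $d(f(x),f(y))\leq d(x,y)$ for all $x,y$. $\mathsf{c}$ and $\mathsf{L}$ are the sets of all contractions and of all nonexpansive functions, respectively. $A\leq_{\mathsf{c}}B$ iff $A=B$ or $A=f^{ -1}(B)$ for some $f\in\mathsf{c}$; $A\leq_{\mathsf{L}}B$ iff $A=f^{ -1}(B)$ for some $f\in\mathsf{L}$. For $\mathcal{F}\in\{\mathsf{c},\mathsf{L}\}$, $A<_{\mathcal{F}}B$ iff $A\leq_{\mathcal{F}}B$ and $B\nleq_{\mathcal{F}}A$. A preorder is well-founded if it has no infinite strictly descending sequence. Lipschitz game $G_{\mathsf{L}}(A,B)$: players I and II alternately play natural numbers (I first), I producing $a\in\omega^\omega$ and II producing $b\in\omega^\omega$; II wins iff ($a\in A\iff b\in B$). $\mathsf{AD}^{\mathsf{L}}$: for all $A,B\subseteq\omega^\omega$ the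 game $G_{\mathsf{L}}(A,B)$ is determined. $\mathsf{BP}$: every subset of $\omega^\omega$ has the Baire property. -}

module Defs where

open import Level using (Level; _⊔_; 0ℓ)
open import Data.Nat.Base using (ℕ; zero; suc)
import Data.Nat.Base as ℕ
open import Data.List.Base using (List; applyUpTo)
open import Data.Product.Base using (Σ; ∃; _×_; _,_; proj₁; proj₂)
open import Data.Sum.Base using (_⊎_)
open import Data.Rational.Base using (ℚ; 0ℚ; 1ℚ; ½; nonNegative; positive)
import Data.Rational.Base as ℚ
import Data.Rational.Properties as ℚₚ
open import Function.Base using (id; _∘_)
open import Function.Bundles using (_⇔_)
open import Relation.Binary.Core using (Rel)
import Relation.Binary.Definitions as Binary
open import Relation.Binary.PropositionalEquality.Core using (_≡_; _≢_; _≗_)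
open import Relation.Nullary.Negation.Core using (¬_)
open import Relation.Nullary.Decidable.Core using (decidable-stable)
open import Relation.Unary using (Pred; Stable; ∁; _∪_; _∖_; _⊢_; _≐_; _⊆_)

private
  variable
    a p r : Level

-- The mathematics is classical (ZF), so existence and disjunction are read
-- through the double-negation translation.  An untruncated Σ or ⊎ in a
-- hypothesis such as AD-L below would amount to a choice function, which is
-- more than ZF + DC(ℝ) provides.

∃ᶜ : {A : Set a} → Pred A p → Set (a ⊔ p)
∃ᶜ P = ¬ ¬ ∃ P

infixr 1 _⊎ᶜ_

_⊎ᶜ_ : Set a → Set p → Set (a ⊔ p)
P ⊎ᶜ Q = ¬ ¬ (P ⊎ Q)

Strict : {A : Set a} → Rel A r → Rel A r
Strict _≲_ x y = (x ≲ y) × ¬ (y ≲ x)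

WellFoundedPreorder : {A : Set a} → Rel A r → Set (a ⊔ r)
WellFoundedPreorder {A = A} _≲_ =
  ¬ (Σ (ℕ → A) λ s → ∀ n → Strict _≲_ (s (suc n)) (s n))

-- Nonnegative reals as Dedekind cuts: r is given by { q ∈ ℚ ∣ 0 ≤ q < r },
-- so that 0 is the empty cut.

record ℝ≥0 : Set₁ where
  field
    below        : Pred ℚ 0ℓ
    below-stable : Stable below
    nonneg       : ∀ {q} → below q → 0ℚ ℚ.≤ q
    down         : ∀ {q q′} → 0ℚ ℚ.≤ q → q ℚ.≤ q′ → below q′ → below q
    rounded      : ∀ {q} → below q → ∃ᶜ λ q′ → q ℚ.< q′ × below q′
    bounded      : ∃ᶜ λ u → ∀ {q} → below q → q ℚ.≤ u

open ℝ≥0 public using (below)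

infix 4 _≤ᴿ_ _<ᴿ_

_≤ᴿ_ : Rel ℝ≥0 0ℓ
r ≤ᴿ s = below r ⊆ below s

_<ᴿ_ : Rel ℝ≥0 0ℓ
_<ᴿ_ = Strict _≤ᴿ_

1ᴿ : ℝ≥0
1ᴿ = record
  { below        = λ q → 0ℚ ℚ.≤ q × q ℚ.< 1ℚ
  ; below-stable = λ q h → decidable-stable (0ℚ ℚₚ.≤? q) (λ n → h (n ∘ proj₁))
                         , decidable-stable (q ℚₚ.<? 1ℚ) (λ n → h (n ∘ proj₂))
  ; nonneg       = proj₁
  ; down         = λ 0≤q q≤q′ (_ , q′<1) → 0≤q , ℚₚ.≤-<-trans q≤q′ q′<1
  ; rounded      = λ (0≤q , q<1) k → let (m , q<m , m<1) = ℚₚ.<-dense q<1 in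
                     k (m , q<m , ℚₚ.≤-trans 0≤q (ℚₚ.<⇒≤ q<m) , m<1)
  ; bounded      = λ k → k (1ℚ , λ (_ , q<1) → ℚₚ.<⇒≤ q<1)
  }

infixl 7 _*ᴿ_

_*ᴿ_ : ℝ≥0 → ℝ≥0 → ℝ≥0
r *ᴿ s = record
  { below        = λ q → 0ℚ ℚ.≤ q × ∃ᶜ λ ((a , b) : ℚ × ℚ) →
                     below r a × below s b × q ℚ.≤ a ℚ.* b
  ; below-stable = λ q h → decidable-stable (0ℚ ℚₚ.≤? q) (λ n → h (n ∘ proj₁))
                         , λ n → h (λ (_ , e) → e n)
  ; nonneg       = proj₁
  ; down         = λ 0≤q q≤q′ (_ , e) → 0≤q , λ k → e λ (ab , ra , sb , q′≤ab) →
                     k (ab , ra , sb , ℚₚ.≤-trans q≤q′ q′≤ab)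
  ; rounded      = λ (0≤q , e) k → e λ ((a , b) , ra , sb , q≤ab) →
                     R.rounded ra λ (a′ , a<a′ , ra′) →
                     S.rounded sb λ (b′ , b<b′ , sb′) →
                     let q<a′b′ = ℚₚ.≤-<-trans q≤ab (<-prod (R.nonneg ra) (S.nonneg sb) a<a′ b<b′)
                     in k ( a′ ℚ.* b′ , q<a′b′ , ℚₚ.≤-trans 0≤q (ℚₚ.<⇒≤ q<a′b′)
                          , λ j → j ((a′ , b′) , ra′ , sb′ , ℚₚ.≤-refl) )
  ; bounded      = λ k → R.bounded λ (u , r≤u) → S.bounded λ (v , s≤v) →
                     k (u ℚ.* v , λ {q} (_ , e) → decidable-stable (q ℚₚ.≤? u ℚ.* v)
                       λ n → e λ (_ , ra , sb , q≤ab) →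
                         n (ℚₚ.≤-trans q≤ab (≤-prod (R.nonneg ra) (S.nonneg sb) (r≤u ra) (s≤v sb))))
  }
  where
  module R = ℝ≥0 r
  module S = ℝ≥0 s

  ≤-prod : ∀ {a b u v} → 0ℚ ℚ.≤ a → 0ℚ ℚ.≤ b → a ℚ.≤ u → b ℚ.≤ v → a ℚ.* b ℚ.≤ u ℚ.* v
  ≤-prod {b = b} {u = u} 0≤a 0≤b a≤u b≤v = ℚₚ.≤-trans
    (ℚₚ.*-monoʳ-≤-nonNeg b {{nonNegative 0≤b}} a≤u)
    (ℚₚ.*-monoˡ-≤-nonNeg u {{nonNegative (ℚₚ.≤-trans 0≤a a≤u)}} b≤v)

  <-prod : ∀ {a b u v} → 0ℚ ℚ.≤ a → 0ℚ ℚ.≤ b → a ℚ.< u → b ℚ.< v → a ℚ.* b ℚ.< u ℚ.* v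
  <-prod {a} {v = v} 0≤a 0≤b a<u b<v = ℚₚ.≤-<-trans
    (ℚₚ.*-monoˡ-≤-nonNeg a {{nonNegative 0≤a}} (ℚₚ.<⇒≤ b<v))
    (ℚₚ.*-monoˡ-<-pos v {{positive (ℚₚ.≤-<-trans 0≤b b<v)}} a<u)

-- Points of the Baire space are compared by pointwise equality _≗_.

ω^ω : Set
ω^ω = ℕ → ℕ

FirstDifference : ω^ω → ω^ω → Pred ℕ 0ℓ
FirstDifference x y n = x n ≢ y n × (∀ m → m ℕ.< n → x m ≡ y m)

2⁻_ : ℕ → ℚ
2⁻ zero    = 1ℚ
2⁻ (suc n) = ½ ℚ.* 2⁻ n

-- The cut is empty when x and y agree everywhere, and is the cut of 2⁻ n when
-- n is the first place where they differ.

d : ω^ω → ω^ω → ℝ≥0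
d x y = record
  { below        = λ q → 0ℚ ℚ.≤ q × ∃ᶜ λ n → FirstDifference x y n × q ℚ.< 2⁻ n
  ; below-stable = λ q h → decidable-stable (0ℚ ℚₚ.≤? q) (λ n → h (n ∘ proj₁))
                         , λ n → h (λ (_ , e) → e n)
  ; nonneg       = proj₁
  ; down         = λ 0≤q q≤q′ (_ , e) → 0≤q , λ k → e λ (n , fd , q′<) →
                     k (n , fd , ℚₚ.≤-<-trans q≤q′ q′<)
  ; rounded      = λ (0≤q , e) k → e λ (n , fd , q<) →
                     let (m , q<m , m<) = ℚₚ.<-dense q< in
                     k (m , q<m , ℚₚ.≤-trans 0≤q (ℚₚ.<⇒≤ q<m) , λ j → j (n , fd , m<))
  ; bounded      = λ k → k (1ℚ , λ {q} (_ , e) → decidable-stable (q ℚₚ.≤? 1ℚ)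
                     λ ¬q≤1 → e λ (n , _ , q<) →
                       ¬q≤1 (ℚₚ.≤-trans (ℚₚ.<⇒≤ q<) (2⁻≤1 n)))
  }
  where
  2⁻≤1 : ∀ n → 2⁻ n ℚ.≤ 1ℚ
  2⁻≤1 zero    = ℚₚ.≤-refl
  2⁻≤1 (suc n) = ℚₚ.≤-trans (ℚₚ.*-monoˡ-≤-nonNeg ½ (2⁻≤1 n))
                            (decidable-stable (½ ℚ.* 1ℚ ℚₚ.≤? 1ℚ) (λ n → n (ℚ.*≤* ½≤1)))
    where
    open import Data.Integer.Base using (+≤+)
    ½≤1 = +≤+ (ℕ.s≤s ℕ.z≤n)

Contraction : Pred (ω^ω → ω^ω) (Level.suc 0ℓ)
Contraction f = ∃ᶜ λ (L : ℝ≥0) → L <ᴿ 1ᴿ × (∀ x y → d (f x) (f y) ≤ᴿ L *ᴿ d x y)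

Nonexpansive : Pred (ω^ω → ω^ω) 0ℓ
Nonexpansive f = ∀ x y → d (f x) (f y) ≤ᴿ d x y

record Subset : Set₁ where
  field
    mem        : Pred ω^ω 0ℓ
    mem-resp   : mem Binary.Respects _≗_
    mem-stable : Stable mem

open Subset public using (mem)

infix 4 _≤ᶜ_ _≤ᴸ_ _<ᶜ_ _<ᴸ_

_≤ᶜ_ : Rel Subset (Level.suc 0ℓ)
A ≤ᶜ B = mem A ≐ mem B ⊎ᶜ ∃ᶜ λ f → Contraction f × mem A ≐ f ⊢ mem B

_≤ᴸ_ : Rel Subset 0ℓ
A ≤ᴸ B = ∃ᶜ λ f → Nonexpansive f × mem A ≐ f ⊢ mem B

_<ᶜ_ : Rel Subset (Level.suc 0ℓ)
_<ᶜ_ = Strict _≤ᶜ_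

_<ᴸ_ : Rel Subset 0ℓ
_<ᴸ_ = Strict _≤ᴸ_

-- A strategy maps the finite sequence of all moves made so far to the next
-- move.  In a play z, player I makes the moves with even index and player II
-- those with odd index.

Strategy : Set
Strategy = List ℕ → ℕ

evens odds : ω^ω → ω^ω
evens z n = z (2 ℕ.* n)
odds  z n = z (suc (2 ℕ.* n))

FollowedByI FollowedByII : Strategy → Pred ω^ω 0ℓ
FollowedByI  σ z = ∀ n → z (2 ℕ.* n) ≡ σ (applyUpTo z (2 ℕ.* n))
FollowedByII τ z = ∀ n → z (suc (2 ℕ.* n)) ≡ τ (applyUpTo z (suc (2 ℕ.* n)))

IIWinsPlay : Subset → Subset → Pred ω^ω 0ℓ
IIWinsPlay A B z = mem A (evens z) ⇔ mem B (odds z)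

Determined : Rel Subset 0ℓ
Determined A B =
    (∃ᶜ λ σ → FollowedByI  σ ⊆ ∁ (IIWinsPlay A B))
  ⊎ᶜ (∃ᶜ λ τ → FollowedByII τ ⊆ IIWinsPlay A B)

AD-L : Set₁
AD-L = ∀ A B → Determined A B

DC-ℝ : Set₁
DC-ℝ = (R : Rel ω^ω 0ℓ) →
       R Binary.Respects₂ _≗_ → Binary.Stable R →
       (∀ x → ∃ᶜ λ y → R x y) →
       ∃ᶜ λ (s : ℕ → ω^ω) → ∀ n → R (s n) (s (suc n))

Cylinder : ω^ω → ℕ → Pred ω^ω 0ℓ
Cylinder x n y = ∀ m → m ℕ.< n → x m ≡ y m

Interior : Pred ω^ω p → Pred ω^ω p
Interior P x = ∃ᶜ λ n → Cylinder x n ⊆ P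

Closure : Pred ω^ω p → Pred ω^ω p
Closure P x = ∀ n → ∃ᶜ λ y → Cylinder x n y × P y

Open NowhereDense : Pred Subset 0ℓ
Open U         = mem U ⊆ Interior (mem U)
NowhereDense N = ∀ x → ¬ Interior (Closure (mem N)) x

Meager : Pred ω^ω p → Set (Level.suc 0ℓ ⊔ p)
Meager P = ∃ᶜ λ (N : ℕ → Subset) →
  (∀ n → NowhereDense (N n)) × P ⊆ (λ x → ∃ᶜ λ n → mem (N n) x)

BaireProperty : Pred Subset (Level.suc 0ℓ)
BaireProperty A = ∃ᶜ λ U →
  Open U × Meager ((mem A ∖ mem U) ∪ (mem U ∖ mem A))

BP : Set₁
BP = ∀ A → BaireProperty A

{-# OPTIONS --safe #-}
module Submission where

-- A winning strategy of II is a nonexpansive function, and a winning strategy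
-- of I, who moves first, is a contraction.  If A <ᴸ B, then I wins the game of
-- B against A, so the complement of A is the preimage of B under a
-- contraction.  In the game of B against the complement of A, either I wins,
-- and A itself is such a preimage, or II wins, and composing A ≤ᴸ B ≤ᴸ ∁ A
-- with that contraction reduces A to B.  Conversely, if A = f⁻¹(B) with f a
-- contraction and B = g⁻¹(A) with g nonexpansive, then B = (g f g)⁻¹(A).
--
-- Well-foundedness is the Martin–Monk argument.  Along a descending sequence I
-- wins the game of Aₙ against Aₙ₊₁ and against its complement.  Every z ∈ ω^ω
-- selects by the parity of z n one of the two strategies at each n, and playing
-- them against each other produces points xₙ; changing one parity toggles the
-- membership of x₀ in A₀.  The set of z with x₀ ∈ A₀ thus has the same category
-- as its complement in every cylinder, contradicting the Baire property.

open import Defs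
open import Level using (0ℓ)
open import Data.Empty using (⊥)
open import Data.Integer.Base using (+_)
open import Data.List.Base using (List; []; _∷_; _∷ʳ_; applyUpTo; length)
open import Data.List.Properties using (applyUpTo-∷ʳ)
open import Data.Nat.Base
  using (ℕ; zero; suc; _+_; _*_; _∸_; _⊔_; _≤_; _<_; z≤n; s<s; s<s⁻¹; parity)
import Data.Nat.Properties as ℕₚ
open import Data.Parity.Base using (Parity; 0ℙ; 1ℙ; _⁻¹)
open import Data.Product.Base using (∃; _×_; _,_; proj₁; proj₂; uncurry)
open import Data.Rational.Base using (ℚ; 0ℚ; 1ℚ; ½; nonNegative)
import Data.Rational.Base as ℚ
import Data.Rational.Properties as ℚₚ
open import Data.Sum.Base using (_⊎_; inj₁; inj₂)
open import Function.Base using (id; _∘_; _∘′_; case_of_)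
open import Function.Bundles using (_⇔_; mk⇔; Equivalence)
open import Function.Construct.Composition using (_⇔-∘_)
open import Function.Construct.Symmetry using (⇔-sym)
open import Relation.Binary.Core using (Rel)
import Relation.Binary.Definitions as Binary
open import Relation.Binary.PropositionalEquality
  using (_≡_; _≗_; refl; sym; trans; cong; cong₂; subst; subst₂; module ≡-Reasoning)
open import Relation.Nullary.Decidable
  using (yes; no; decidable-stable; from-yes; ¬¬-excluded-middle)
open import Relation.Nullary.Negation.Core using (¬_; contradiction)
open import Relation.Unary using (Pred; Stable; ∁; _∪_; _⊢_; _≐_; _⊆_)

open Equivalence using (to; from)

private
  variable
    x y z : ω^ω
    m n : ℕ
    f g : ω^ω → ω^ω
    A B C : Subset

-- Lipschitz functions

-- Lipschitz constants 1 and ½, expressed digit by digit.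
Causal StrictlyCausal : Pred (ω^ω → ω^ω) 0ℓ
Causal         f = ∀ {x y} n → Cylinder x (suc n) y → f x n ≡ f y n
StrictlyCausal f = ∀ {x y} n → Cylinder x n y → f x n ≡ f y n

⌊_⌋ᴿ : ℚ → ℝ≥0
⌊ r ⌋ᴿ = record
  { below        = λ q → 0ℚ ℚ.≤ q × q ℚ.< r
  ; below-stable = λ q h → decidable-stable (0ℚ ℚₚ.≤? q) (λ n → h (n ∘ proj₁))
                         , decidable-stable (q ℚₚ.<? r) (λ n → h (n ∘ proj₂))
  ; nonneg       = proj₁
  ; down         = λ 0≤q q≤q′ (_ , q′<r) → 0≤q , ℚₚ.≤-<-trans q≤q′ q′<r
  ; rounded      = λ (0≤q , q<r) k → let (m , q<m , m<r) = ℚₚ.<-dense q<r in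
                     k (m , q<m , ℚₚ.≤-trans 0≤q (ℚₚ.<⇒≤ q<m) , m<r)
  ; bounded      = λ k → k (r , λ (_ , q<r) → ℚₚ.<⇒≤ q<r)
  }

2⁻-nonneg : ∀ n → 0ℚ ℚ.≤ 2⁻ n
2⁻-nonneg zero    = from-yes (0ℚ ℚₚ.≤? 1ℚ)
2⁻-nonneg (suc n) = ℚₚ.*-monoˡ-≤-nonNeg ½ (2⁻-nonneg n)

2⁻-suc-≤ : ∀ n → 2⁻ (suc n) ℚ.≤ 2⁻ n
2⁻-suc-≤ n = subst (2⁻ (suc n) ℚ.≤_) (ℚₚ.*-identityˡ (2⁻ n))
  (ℚₚ.*-monoʳ-≤-nonNeg (2⁻ n) {{nonNegative (2⁻-nonneg n)}} (from-yes (½ ℚₚ.≤? 1ℚ)))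

2⁻-antitone : m ≤ n → 2⁻ n ℚ.≤ 2⁻ m
2⁻-antitone {n = zero}  z≤n = ℚₚ.≤-refl
2⁻-antitone {n = suc n} m≤n with ℕₚ.m≤n⇒m<n∨m≡n m≤n
... | inj₁ m<1+n = ℚₚ.≤-trans (2⁻-suc-≤ n) (2⁻-antitone (ℕₚ.≤-pred m<1+n))
... | inj₂ refl  = ℚₚ.≤-refl

cylinder-suc : Cylinder x n y → x n ≡ y n → Cylinder x (suc n) y
cylinder-suc x~y xₙ≡yₙ m m<1+n with ℕₚ.m<1+n⇒m<n∨m≡n m<1+n
... | inj₁ m<n  = x~y m m<n
... | inj₂ refl = xₙ≡yₙ

-- A search below `n` is finite, so the split is constructive and yields an explicit witness for the
-- existence statement in `d`.
cylinder⊎firstDifference : ∀ x y n → Cylinder x n y ⊎ ∃ λ m → m < n × FirstDifference x y m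
cylinder⊎firstDifference x y zero = inj₁ λ _ ()
cylinder⊎firstDifference x y (suc n) with cylinder⊎firstDifference x y n | x n ℕₚ.≟ y n
... | inj₂ (m , m<n , fd) | _         = inj₂ (m , ℕₚ.m<n⇒m<1+n m<n , fd)
... | inj₁ x~y            | yes xₙ≡yₙ = inj₁ (cylinder-suc x~y xₙ≡yₙ)
... | inj₁ x~y            | no  xₙ≢yₙ = inj₂ (n , ℕₚ.≤-refl , xₙ≢yₙ , x~y)

causal⇒nonexpansive : Causal f → Nonexpansive f
causal⇒nonexpansive causal x y (0≤q , e) = 0≤q , λ k → e λ (n , (fx≢fy , _) , q<2⁻n) →
  case cylinder⊎firstDifference x y (suc n) of λ where
    (inj₁ x~y)             → fx≢fy (causal n x~y)
    (inj₂ (m , m<1+n , fd)) →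
      k (m , fd , ℚₚ.<-≤-trans q<2⁻n (2⁻-antitone (ℕₚ.≤-pred m<1+n)))

-- The Lipschitz constant is really ½, but a product of two cuts consists of
-- products of strictly smaller rationals; with ¾ in place of ½ the witness for
-- q < ½ · 2⁻ᵐ is q = ½ · 2q.

strictlyCausal⇒contraction : StrictlyCausal f → Contraction f
strictlyCausal⇒contraction {f} causal k = k (⌊ ¾ ⌋ᴿ , (¾≤1 , 1≰¾) , contracts)
  where
  ¾ 2ℚ : ℚ
  ¾  = + 3 ℚ./ 4
  2ℚ = + 2 ℚ./ 1

  ¾<1 : ¾ ℚ.< 1ℚ
  ¾<1 = from-yes (¾ ℚₚ.<? 1ℚ)

  ¾≤1 : ⌊ ¾ ⌋ᴿ ≤ᴿ 1ᴿ
  ¾≤1 (0≤q , q<¾) = 0≤q , ℚₚ.<-trans q<¾ ¾<1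

  1≰¾ : ¬ (1ᴿ ≤ᴿ ⌊ ¾ ⌋ᴿ)
  1≰¾ h = ℚₚ.<-irrefl refl (proj₂ (h (from-yes (0ℚ ℚₚ.≤? ¾) , ¾<1)))

  half-double : ∀ q → ½ ℚ.* (2ℚ ℚ.* q) ≡ q
  half-double q = trans (sym (ℚₚ.*-assoc ½ 2ℚ q)) (ℚₚ.*-identityˡ q)

  contracts : ∀ x y → d (f x) (f y) ≤ᴿ ⌊ ¾ ⌋ᴿ *ᴿ d x y
  contracts x y {q} (0≤q , e) = 0≤q , λ k → e λ (n , (fx≢fy , _) , q<2⁻n) →
    case cylinder⊎firstDifference x y n of λ where
      (inj₁ x~y)            → fx≢fy (causal n x~y)
      (inj₂ (m , m<n , fd)) →
        k ( (½ , 2ℚ ℚ.* q)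
          , (from-yes (0ℚ ℚₚ.≤? ½) , from-yes (½ ℚₚ.<? ¾))
          , ( ℚₚ.*-monoˡ-≤-nonNeg 2ℚ 0≤q
            , λ j → j (m , fd , ℚₚ.*-cancelˡ-<-nonNeg ½
                (subst (ℚ._< 2⁻ (suc m)) (sym (half-double q))
                  (ℚₚ.<-≤-trans q<2⁻n (2⁻-antitone m<n)))) )
          , ℚₚ.≤-reflexive (sym (half-double q)) )

-- In a witness `q ≤ a * b` the factor `a` is below 1, so `q ≤ b`, and `b` lies in the cut of
-- `d x y`.
contraction⇒nonexpansive : Contraction f → Nonexpansive f
contraction⇒nonexpansive {f} cf x y {q} fxfy = ℝ≥0.below-stable (d x y) q λ k →
  cf λ (L , (L≤1 , _) , contracts) →
    let (0≤q , e) = contracts x y fxfy in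
    e λ ((a , b) , La , db , q≤ab) →
      let 0≤b = ℝ≥0.nonneg (d x y) {b} db
          ab≤b = subst (a ℚ.* b ℚ.≤_) (ℚₚ.*-identityˡ b)
                   (ℚₚ.*-monoʳ-≤-nonNeg b {{nonNegative 0≤b}} (ℚₚ.<⇒≤ (proj₂ (L≤1 La))))
      in k (ℝ≥0.down (d x y) 0≤q (ℚₚ.≤-trans q≤ab ab≤b) db)

nonexpansive-∘ : Nonexpansive f → Nonexpansive g → Nonexpansive (f ∘ g)
nonexpansive-∘ {g = g} nf ng x y = ng x y ∘′ nf (g x) (g y)

nonexpansive∘contraction : Nonexpansive f → Contraction g → Contraction (f ∘ g)
nonexpansive∘contraction {g = g} nf cg k = cg λ (L , L<1 , contracts) →
  k (L , L<1 , λ x y → contracts x y ∘′ nf (g x) (g y))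

contraction∘nonexpansive : Contraction f → Nonexpansive g → Contraction (f ∘ g)
contraction∘nonexpansive {g = g} cf ng k = cf λ (L , L<1 , contracts) →
  k (L , L<1 , λ x y fgxfgy →
    let (0≤q , e) = contracts (g x) (g y) fgxfgy in
    0≤q , λ j → e λ (ab , La , db , q≤ab) → j (ab , La , ng x y db , q≤ab))

-- Reducibilities

_ᶜ : Subset → Subset
A ᶜ = record
  { mem        = ∁ (mem A)
  ; mem-resp   = λ x≗y x∉A y∈A → x∉A (Subset.mem-resp A (sym ∘ x≗y) y∈A)
  ; mem-stable = λ _ h x∈A → h λ x∉A → x∉A x∈A
  }

ᶜᶜ-elim : ∀ A → mem ((A ᶜ) ᶜ) ⊆ mem A
ᶜᶜ-elim A = Subset.mem-stable A _

mem-cong : ∀ A → x ≗ y → mem A x ⇔ mem A y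
mem-cong A x≗y = mk⇔ (Subset.mem-resp A x≗y) (Subset.mem-resp A (sym ∘ x≗y))

≤ᴸ-trans : A ≤ᴸ B → B ≤ᴸ C → A ≤ᴸ C
≤ᴸ-trans A≤B B≤C k =
  A≤B λ (f , nf , A⊆ , ⊆A) → B≤C λ (g , ng , B⊆ , ⊆B) →
  k (g ∘ f , nonexpansive-∘ ng nf , B⊆ ∘ A⊆ , ⊆A ∘ ⊆B)

ᶜ-mono-≤ᴸ : A ≤ᴸ B → A ᶜ ≤ᴸ B ᶜ
ᶜ-mono-≤ᴸ A≤B k = A≤B λ (f , nf , A⊆ , ⊆A) → k (f , nf , (_∘ ⊆A) , (_∘ A⊆))

≤ᴸ-ᶜᶜ : A ≤ᴸ (A ᶜ) ᶜ
≤ᴸ-ᶜᶜ {A} k = k (id , (λ _ _ → id) , (λ x∈A x∉A → x∉A x∈A) , ᶜᶜ-elim A)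

ᶜᶜ-≤ᴸ : (A ᶜ) ᶜ ≤ᴸ A
ᶜᶜ-≤ᴸ {A} k = k (id , (λ _ _ → id) , ᶜᶜ-elim A , λ x∈A x∉A → x∉A x∈A)

≤ᶜ⇒≤ᴸ : A ≤ᶜ B → A ≤ᴸ B
≤ᶜ⇒≤ᴸ A≤B k = A≤B λ where
  (inj₁ A≐B) → k (id , (λ _ _ → id) , A≐B)
  (inj₂ e)   → e λ (f , cf , A≐) → k (f , contraction⇒nonexpansive cf , A≐)

ContractsTo : Rel Subset _
ContractsTo A B = ∃ᶜ λ f → Contraction f × mem A ≐ f ⊢ mem B

≤ᴸ-contractsTo-trans : A ≤ᴸ B → ContractsTo B C → ContractsTo A C
≤ᴸ-contractsTo-trans A≤B B≤C k =
  A≤B λ (f , nf , A⊆ , ⊆A) → B≤C λ (g , cg , B⊆ , ⊆B) →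
  k (g ∘ f , contraction∘nonexpansive cg nf , B⊆ ∘ A⊆ , ⊆A ∘ ⊆B)

contractsTo-≤ᴸ-trans : ContractsTo A B → B ≤ᴸ C → ContractsTo A C
contractsTo-≤ᴸ-trans A≤B B≤C k =
  A≤B λ (f , cf , A⊆ , ⊆A) → B≤C λ (g , ng , B⊆ , ⊆B) →
  k (g ∘ f , nonexpansive∘contraction ng cf , B⊆ ∘ A⊆ , ⊆A ∘ ⊆B)

<ᶜ⇒<ᴸ : A <ᶜ B → A <ᴸ B
<ᶜ⇒<ᴸ {A} {B} (A≤B , B≰A) = ≤ᶜ⇒≤ᴸ {A} {B} A≤B , λ B≤A → A≤B λ where
  (inj₁ (A⊆B , B⊆A)) → B≰A λ k → k (inj₁ (B⊆A , A⊆B))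
  (inj₂ c)           → B≰A λ k → k (inj₂
    (contractsTo-≤ᴸ-trans {B} {B} {A} (≤ᴸ-contractsTo-trans {B} {A} {B} B≤A c) B≤A))

-- Strategies

-- The arguments swap roles at each step, so that `odds` of an interleaving is by definition `evens`
-- of another one.
interleave : ω^ω → ω^ω → ω^ω
interleave a b zero    = a 0
interleave a b (suc n) = interleave b (a ∘ suc) n

evens-interleave : ∀ a b → evens (interleave a b) ≗ a
evens-interleave a b zero    = refl
evens-interleave a b (suc n) = trans (cong (interleave a b) (ℕₚ.*-suc 2 n))
                                     (evens-interleave (a ∘ suc) (b ∘ suc) n)

odds-interleave : ∀ a b → odds (interleave a b) ≗ b
odds-interleave a b = evens-interleave b (a ∘ suc)

-- Strategies may vary with the round, so that one construction covers both a player following a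
-- strategy and a player spelling out a given point.
module Play (α β : ℕ → Strategy) where

  history history⁺ : ℕ → List ℕ
  moveᴵ moveᴵᴵ : ω^ω
  history zero    = []
  history (suc n) = history⁺ n ∷ʳ moveᴵᴵ n
  history⁺ n      = history n ∷ʳ moveᴵ n
  moveᴵ n         = α n (history n)
  moveᴵᴵ n        = β n (history⁺ n)

  play : ω^ω
  play = interleave moveᴵ moveᴵᴵ

  applyUpTo-play : ∀ n → applyUpTo play (2 * n) ≡ history n
  applyUpTo-play⁺ : ∀ n → applyUpTo play (suc (2 * n)) ≡ history⁺ n

  applyUpTo-play zero    = refl
  applyUpTo-play (suc n) = begin
    applyUpTo play (2 * suc n)
      ≡⟨ cong (applyUpTo play) (ℕₚ.*-suc 2 n) ⟩
    applyUpTo play (suc (suc (2 * n)))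
      ≡⟨ applyUpTo-∷ʳ play (suc (2 * n)) ⟨
    applyUpTo play (suc (2 * n)) ∷ʳ odds play n
      ≡⟨ cong₂ _∷ʳ_ (applyUpTo-play⁺ n) (odds-interleave moveᴵ moveᴵᴵ n) ⟩
    history (suc n) ∎
    where open ≡-Reasoning

  applyUpTo-play⁺ n = begin
    applyUpTo play (suc (2 * n))
      ≡⟨ applyUpTo-∷ʳ play (2 * n) ⟨
    applyUpTo play (2 * n) ∷ʳ evens play n
      ≡⟨ cong₂ _∷ʳ_ (applyUpTo-play n) (evens-interleave moveᴵ moveᴵᴵ n) ⟩
    history⁺ n ∎
    where open ≡-Reasoning

open Play using (history; history⁺; moveᴵ; moveᴵᴵ; play)

history-cong : ∀ {α α′ β β′} n → (∀ m → m < n → α m ≗ α′ m) → (∀ m → m < n → β m ≗ β′ m) →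
               history α β n ≡ history α′ β′ n
history-cong zero    _  _  = refl
history-cong {α} {α′} {β} {β′} (suc n) α~ β~ =
  cong₂ _∷ʳ_ h⁺ (trans (cong (β n) h⁺) (β~ n ℕₚ.≤-refl _))
  where
  h : history α β n ≡ history α′ β′ n
  h = history-cong n (λ m → α~ m ∘ ℕₚ.m<n⇒m<1+n) (λ m → β~ m ∘ ℕₚ.m<n⇒m<1+n)

  h⁺ : history⁺ α β n ≡ history⁺ α′ β′ n
  h⁺ = cong₂ _∷ʳ_ h (trans (cong (α n) h) (α~ n ℕₚ.≤-refl _))

playing : ω^ω → ℕ → Strategy
playing x n _ = x n

responseᴵ responseᴵᴵ : Strategy → ω^ω → ω^ω
responseᴵ  σ y = moveᴵ (λ _ → σ) (playing y)
responseᴵᴵ τ x = moveᴵᴵ (playing x) (λ _ → τ)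

-- Player I makes move `n` having seen only the earlier moves of II, whereas II answers with move
-- `n` of I already made.
responseᴵ-strictlyCausal : ∀ σ → StrictlyCausal (responseᴵ σ)
responseᴵ-strictlyCausal σ n x~y =
  cong σ (history-cong n (λ _ _ _ → refl) (λ m m<n _ → x~y m m<n))

responseᴵᴵ-causal : ∀ τ → Causal (responseᴵᴵ τ)
responseᴵᴵ-causal τ n x~y =
  cong τ (cong₂ _∷ʳ_ (history-cong n (λ m m<n _ → x~y m (ℕₚ.m<n⇒m<1+n m<n)) (λ _ _ _ → refl))
                     (x~y n ℕₚ.≤-refl))

Winningᴵ Winningᴵᴵ : Strategy → Rel Subset 0ℓ
Winningᴵ  σ A B = ∀ z → FollowedByI  σ z → ¬ IIWinsPlay A B z
Winningᴵᴵ τ A B = ∀ z → FollowedByII τ z → IIWinsPlay A B z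

play-result : ∀ A B α β →
              IIWinsPlay A B (play α β) ⇔ (mem A (moveᴵ α β) ⇔ mem B (moveᴵᴵ α β))
play-result A B α β = mk⇔
  (λ w → mk⇔ (to B~ ∘ to w ∘ from A~) (to A~ ∘ from w ∘ from B~))
  (λ w → mk⇔ (from B~ ∘ to w ∘ to A~) (from A~ ∘ from w ∘ to B~))
  where
  A~ = mem-cong A (evens-interleave (moveᴵ α β) (moveᴵᴵ α β))
  B~ = mem-cong B (odds-interleave (moveᴵ α β) (moveᴵᴵ α β))

module _ (A B : Subset) where

  winningᴵ⇒responseᴵ : ∀ σ → Winningᴵ σ A B → ∀ y → ¬ (mem A (responseᴵ σ y) ⇔ mem B y)
  winningᴵ⇒responseᴵ σ wins y iff =
    wins (play α β) followed (from (play-result A B α β) iff)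
    where
    α = λ _ → σ
    β = playing y

    followed : FollowedByI σ (play α β)
    followed n = trans (evens-interleave (responseᴵ σ y) y n)
                       (cong σ (sym (Play.applyUpTo-play α β n)))

  winningᴵᴵ⇒responseᴵᴵ : ∀ τ → Winningᴵᴵ τ A B → ∀ x → mem A x ⇔ mem B (responseᴵᴵ τ x)
  winningᴵᴵ⇒responseᴵᴵ τ wins x = to (play-result A B α β) (wins (play α β) followed)
    where
    α = playing x
    β = λ _ → τ

    followed : FollowedByII τ (play α β)
    followed n = trans (odds-interleave x (responseᴵᴵ τ x) n)
                       (cong τ (sym (Play.applyUpTo-play⁺ α β n)))

  winningᴵ⇒contractsTo : ∀ σ → Winningᴵ σ A B → ContractsTo (B ᶜ) A
  winningᴵ⇒contractsTo σ wins k =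
    k ( responseᴵ σ , strictlyCausal⇒contraction (responseᴵ-strictlyCausal σ)
      , (λ {y} y∉B → Subset.mem-stable A _ λ σy∉A → winningᴵ⇒responseᴵ σ wins y
          (mk⇔ (λ σy∈A → contradiction σy∈A σy∉A) (λ y∈B → contradiction y∈B y∉B)))
      , (λ {y} σy∈A y∈B → winningᴵ⇒responseᴵ σ wins y (mk⇔ (λ _ → y∈B) (λ _ → σy∈A))) )

  winningᴵᴵ⇒≤ᴸ : ∀ τ → Winningᴵᴵ τ A B → A ≤ᴸ B
  winningᴵᴵ⇒≤ᴸ τ wins k =
    k ( responseᴵᴵ τ , causal⇒nonexpansive (responseᴵᴵ-causal τ)
      , (λ {x} → to (winningᴵᴵ⇒responseᴵᴵ τ wins x))
      , (λ {x} → from (winningᴵᴵ⇒responseᴵᴵ τ wins x)) )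

  winningᴵ⊎≤ᴸ : AD-L → (∃ λ σ → Winningᴵ σ A B) ⊎ᶜ A ≤ᴸ B
  winningᴵ⊎≤ᴸ ad k = ad A B λ where
    (inj₁ e) → e λ (σ , wins) → k (inj₁ (σ , λ z → wins {z}))
    (inj₂ e) → e λ (τ , wins) → k (inj₂ (winningᴵᴵ⇒≤ᴸ τ λ z → wins {z}))

  ≰ᴸ⇒winningᴵ : AD-L → ¬ (A ≤ᴸ B) → ∃ᶜ λ σ → Winningᴵ σ A B
  ≰ᴸ⇒winningᴵ ad A≰B k = winningᴵ⊎≤ᴸ ad λ where
    (inj₁ winning) → k winning
    (inj₂ A≤B)     → A≰B A≤B

<ᴸ⇒<ᶜ : AD-L → A <ᴸ B → A <ᶜ B
<ᴸ⇒<ᶜ {A} {B} ad (A≤B , B≰A) = (λ k → k (inj₂ A⇒B)) , B≰A ∘ ≤ᶜ⇒≤ᴸ {B} {A}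
  where
  Aᶜ⇒B : ContractsTo (A ᶜ) B
  Aᶜ⇒B k = ≰ᴸ⇒winningᴵ B A ad B≰A λ (σ , wins) → winningᴵ⇒contractsTo B A σ wins k

  A⇒B : ContractsTo A B
  A⇒B k = winningᴵ⊎≤ᴸ B (A ᶜ) ad λ where
    (inj₁ (σ , wins)) → ≤ᴸ-contractsTo-trans {A} {(A ᶜ) ᶜ} {B}
      (≤ᴸ-ᶜᶜ {A}) (winningᴵ⇒contractsTo B (A ᶜ) σ wins) k
    (inj₂ B≤Aᶜ)       → ≤ᴸ-contractsTo-trans {A} {A ᶜ} {B}
      (≤ᴸ-trans {A} {B} {A ᶜ} A≤B B≤Aᶜ) Aᶜ⇒B k

-- Coding strategies by points of the Baire space

infixr 5 _◂_

_◂_ : ℕ → ω^ω → ω^ω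
(n ◂ x) zero    = n
(n ◂ x) (suc i) = x i

-- Cantor's enumeration of pairs: along an antidiagonal, then from its end `(s , 0)` to
-- `(0 , suc s)`.
nextPair : ℕ × ℕ → ℕ × ℕ
nextPair (m , zero)  = zero , suc m
nextPair (m , suc n) = suc m , n

unpair : ℕ → ℕ × ℕ
unpair zero    = zero , zero
unpair (suc k) = nextPair (unpair k)

Unpairs : ℕ → ℕ → Set
Unpairs m n = ∃ λ k → unpair k ≡ (m , n)

unpair-along : ∀ m n → Unpairs 0 (m + n) → Unpairs m n
unpair-along zero    n h = h
unpair-along (suc m) n h =
  let (k , eq) = unpair-along m (suc n) (subst (Unpairs 0) (sym (ℕₚ.+-suc m n)) h)
  in suc k , cong nextPair eq

unpair-start : ∀ s → Unpairs 0 s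
unpair-start zero    = 0 , refl
unpair-start (suc s) =
  let h        = subst (Unpairs 0) (sym (ℕₚ.+-identityʳ s)) (unpair-start s)
      (k , eq) = unpair-along s 0 h
  in suc k , cong nextPair eq

unpair-surjective : ∀ m n → Unpairs m n
unpair-surjective m n = unpair-along m n (unpair-start (m + n))

-- The length is coded separately, which makes the recursion structural.
decodeLength : ℕ → ℕ → List ℕ
decodeLength zero    k = []
decodeLength (suc ℓ) k = let (m , k′) = unpair k in m ∷ decodeLength ℓ k′

decodeLength-surjective : ∀ l → ∃ λ k → decodeLength (length l) k ≡ l
decodeLength-surjective []      = 0 , refl
decodeLength-surjective (m ∷ l) =
  let (k′ , eq′) = decodeLength-surjective l
      (k , eq)   = unpair-surjective m k′
  in k , cong₂ _∷_ (cong proj₁ eq) (trans (cong (decodeLength (length l) ∘ proj₂) eq) eq′)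

decode : ℕ → List ℕ
decode k = uncurry decodeLength (unpair k)

decode-surjective : ∀ l → ∃ λ k → decode k ≡ l
decode-surjective l =
  let (k′ , eq′) = decodeLength-surjective l
      (k , eq)   = unpair-surjective (length l) k′
  in k , trans (cong (uncurry decodeLength) eq) eq′

encode : List ℕ → ℕ
encode = proj₁ ∘ decode-surjective

decode-encode : ∀ l → decode (encode l) ≡ l
decode-encode = proj₂ ∘ decode-surjective

-- `DC-ℝ` chooses points, so the two strategies of one stage are packed into a single point.
strategies : ω^ω → Parity → Strategy
strategies c 0ℙ = evens c ∘ encode
strategies c 1ℙ = odds c ∘ encode

code : (Parity → Strategy) → ω^ω
code σ = interleave (σ 0ℙ ∘ decode) (σ 1ℙ ∘ decode)

strategies-cong : ∀ {c c′} → c ≗ c′ → ∀ π → strategies c π ≗ strategies c′ π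
strategies-cong c≗c′ 0ℙ l = c≗c′ _
strategies-cong c≗c′ 1ℙ l = c≗c′ _

strategies-code : ∀ σ π → strategies (code σ) π ≗ σ π
strategies-code σ 0ℙ l = trans (evens-interleave (σ 0ℙ ∘ decode) (σ 1ℙ ∘ decode) (encode l))
                               (cong (σ 0ℙ) (decode-encode l))
strategies-code σ 1ℙ l = trans (odds-interleave (σ 0ℙ ∘ decode) (σ 1ℙ ∘ decode) (encode l))
                               (cong (σ 1ℙ) (decode-encode l))

-- The Martin–Monk construction

twist : Parity → Subset → Subset
twist 0ℙ B = B
twist 1ℙ B = B ᶜ

-- The extensional content of a winning strategy of I. As a negation it is stable, which `DC-ℝ`
-- demands of its relation.
Beats : (ω^ω → ω^ω) → Rel Subset 0ℓ
Beats f A B = ∀ y → ¬ (mem A (f y) ⇔ mem B y)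

responseᴵ-cong : ∀ {σ σ′} → σ ≗ σ′ → ∀ y → responseᴵ σ y ≗ responseᴵ σ′ y
responseᴵ-cong {σ} {σ′} σ≗σ′ y n =
  trans (cong σ (history-cong n (λ _ _ → σ≗σ′) (λ _ _ _ → refl))) (σ≗σ′ _)

beats-cong : ∀ A B → (∀ y → f y ≗ g y) → Beats f A B → Beats g A B
beats-cong A B f≗g beats y iff = beats y (iff ⇔-∘ mem-cong A (f≗g y))

<ᴸ⇒beats-twists : AD-L → ∀ A B → B <ᴸ A →
                  ∃ᶜ λ (σ : Parity → Strategy) → ∀ π → Beats (responseᴵ (σ π)) A (twist π B)
<ᴸ⇒beats-twists ad A B (B≤A , A≰B) k =
  ≰ᴸ⇒winningᴵ A B ad A≰B λ (σ , σ-wins) → ≰ᴸ⇒winningᴵ A (B ᶜ) ad A≰Bᶜ λ (τ , τ-wins) →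
    k ( (λ { 0ℙ → σ ; 1ℙ → τ })
      , (λ { 0ℙ → winningᴵ⇒responseᴵ A B σ σ-wins ; 1ℙ → winningᴵ⇒responseᴵ A (B ᶜ) τ τ-wins }) )
  where
  -- Otherwise `B ≤ᴸ A ≤ᴸ B ᶜ`; complementing gives `B ᶜ ≤ᴸ B`, and hence `A ≤ᴸ B`.
  A≰Bᶜ : ¬ (A ≤ᴸ B ᶜ)
  A≰Bᶜ A≤Bᶜ = A≰B (≤ᴸ-trans {A} {B ᶜ} {B} A≤Bᶜ (≤ᴸ-trans {B ᶜ} {(B ᶜ) ᶜ} {B}
    (ᶜ-mono-≤ᴸ {B} {B ᶜ} (≤ᴸ-trans {B} {A} {B ᶜ} B≤A A≤Bᶜ)) (ᶜᶜ-≤ᴸ {B})))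

Responses : Set
Responses = ℕ → Parity → ω^ω → ω^ω

-- DC(ℝ) provides no control over the first term of the sequence, so the games
-- are chosen along a tail of the descending sequence.
chooseResponses : DC-ℝ → AD-L → (A : ℕ → Subset) → (∀ n → A (suc n) <ᴸ A n) →
  ∃ᶜ λ ((ℓ , F) : ω^ω × Responses) →
    ∀ n π → StrictlyCausal (F n π) × Beats (F n π) (A (ℓ n)) (twist π (A (ℓ (suc n))))
chooseResponses dc ad A desc k = dc R resp stable total λ (s , s-R) →
  k ( ((λ n → s n 0) , λ n π → response (s (suc n)) π)
    , λ n π → responseᴵ-strictlyCausal (strategies (s (suc n) ∘ suc) π) , proj₂ (s-R n) π )
  where
  response : ω^ω → Parity → ω^ω → ω^ω
  response q π = responseᴵ (strategies (q ∘ suc) π)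

  -- `p 0` is an index into the descending sequence; `q ∘ suc` codes the strategies for the games
  -- between the sets with indices `p 0` and `q 0`.
  R : Rel ω^ω 0ℓ
  R p q = q 0 ≡ suc (p 0) × (∀ π → Beats (response q π) (A (p 0)) (twist π (A (q 0))))

  resp : R Binary.Respects₂ _≗_
  resp = (λ {p} {q} {q′} q≗q′ (eq , beats) →
             trans (sym (q≗q′ 0)) eq
           , λ π → subst (λ i → Beats _ (A (p 0)) (twist π (A i))) (q≗q′ 0)
               (beats-cong (A (p 0)) (twist π (A (q 0)))
                 (responseᴵ-cong (strategies-cong (q≗q′ ∘ suc) π)) (beats π)))
       , (λ {q} {p} {p′} p≗p′ (eq , beats) →
             trans eq (cong suc (p≗p′ 0))
           , λ π → subst (λ i → Beats _ (A i) (twist π (A (q 0)))) (p≗p′ 0) (beats π))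

  stable : Binary.Stable R
  stable p q h = decidable-stable (q 0 ℕₚ.≟ suc (p 0)) (λ ¬eq → h (¬eq ∘ proj₁))
               , λ π y iff → h λ (_ , beats) → beats π y iff

  total : ∀ p → ∃ᶜ λ q → R p q
  total p k = <ᴸ⇒beats-twists ad (A (p 0)) (A (suc (p 0))) (desc (p 0)) λ (σ , beats) →
    k ( suc (p 0) ◂ code σ , refl
      , λ π → beats-cong (A (p 0)) (twist π (A (suc (p 0))))
          (responseᴵ-cong (λ l → sym (strategies-code σ π l))) (beats π) )

-- limit F z is the point x₀ of the unique solution of xₙ = F n (parity (z n)) xₙ₊₁.

approx : Responses → ω^ω → ℕ → ω^ω
approx F z zero    = λ _ → 0
approx F z (suc k) = F 0 (parity (z 0)) (approx (F ∘ suc) (z ∘ suc) k)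

limit : Responses → ω^ω → ω^ω
limit F z j = approx F z (suc j) j

CausalResponses : Pred Responses 0ℓ
CausalResponses F = ∀ n π → StrictlyCausal (F n π)

-- Each response gains one digit, so the first `k` digits of stage `k` are final, whatever the
-- default point at stage 0.
approx-suc : ∀ {F} → CausalResponses F → ∀ z k → Cylinder (approx F z k) k (approx F z (suc k))
approx-suc causal z (suc k) j j<1+k =
  causal 0 _ j λ i i<j →
    approx-suc (causal ∘ suc) (z ∘ suc) k i (ℕₚ.<-≤-trans i<j (ℕₚ.≤-pred j<1+k))

approx-limit : ∀ {F} → CausalResponses F → ∀ z k → Cylinder (approx F z k) k (limit F z)
approx-limit causal z (suc k) j j<1+k with ℕₚ.m<1+n⇒m<n∨m≡n j<1+k
... | inj₁ j<k  = trans (sym (approx-suc causal z k j j<k)) (approx-limit causal z k j j<k)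
... | inj₂ refl = refl

-- Digit `j` on the left is computed from stage `j` of the tail, which agrees with the limit of the
-- tail below `j`; strict causality asks for no more.
limit-unfold : ∀ {F} → CausalResponses F → ∀ z →
               limit F z ≗ F 0 (parity (z 0)) (limit (F ∘ suc) (z ∘ suc))
limit-unfold causal z j = causal 0 _ j (approx-limit (causal ∘ suc) (z ∘ suc) j)

approx-cong : ∀ {F} → CausalResponses F → x ≗ y → ∀ k → approx F x k ≗ approx F y k
approx-cong                   causal x≗y zero    j = refl
approx-cong {x} {y} {F} causal x≗y (suc k) j = trans
  (causal 0 _ j λ i _ → approx-cong (causal ∘ suc) (x≗y ∘ suc) k i)
  (cong (λ b → F 0 (parity b) (approx (F ∘ suc) (y ∘ suc) k) j) (x≗y 0))

limit-cong : ∀ {F} → CausalResponses F → x ≗ y → limit F x ≗ limit F y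
limit-cong causal x≗y j = approx-cong causal x≗y (suc j) j

toggle : ℕ → ℕ
toggle zero          = 1
toggle (suc zero)    = 0
toggle (suc (suc n)) = suc (suc (toggle n))

toggle-involutive : ∀ n → toggle (toggle n) ≡ n
toggle-involutive zero          = refl
toggle-involutive (suc zero)    = refl
toggle-involutive (suc (suc n)) = cong (λ n → suc (suc n)) (toggle-involutive n)

parity-toggle : ∀ n → parity (toggle n) ≡ parity n ⁻¹
parity-toggle zero          = refl
parity-toggle (suc zero)    = refl
parity-toggle (suc (suc n)) = parity-toggle n

flipAt : ℕ → ω^ω → ω^ω
flipAt zero    z zero    = toggle (z zero)
flipAt zero    z (suc i) = z (suc i)
flipAt (suc m) z zero    = z zero
flipAt (suc m) z (suc i) = flipAt m (z ∘ suc) i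

flipAt-cylinder : ∀ m z → Cylinder z m (flipAt m z)
flipAt-cylinder (suc m) z zero    _   = refl
flipAt-cylinder (suc m) z (suc i) i<m = flipAt-cylinder m (z ∘ suc) i (s<s⁻¹ i<m)

-- Together with `flipAt-involutive` this makes `flipAt m` an isometry, which therefore transports
-- avoided cylinders.
flipAt-preserves-cylinder : ∀ m → Cylinder x n y → Cylinder (flipAt m x) n (flipAt m y)
flipAt-preserves-cylinder zero    x~y zero    0<n = cong toggle (x~y 0 0<n)
flipAt-preserves-cylinder zero    x~y (suc i) i<n = x~y (suc i) i<n
flipAt-preserves-cylinder (suc m) x~y zero    0<n = x~y 0 0<n
flipAt-preserves-cylinder {n = suc n} (suc m) x~y (suc i) i<n =
  flipAt-preserves-cylinder {n = n} m (λ j j<n → x~y (suc j) (s<s j<n)) i (s<s⁻¹ i<n)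

flipAt-involutive : ∀ m z → flipAt m (flipAt m z) ≗ z
flipAt-involutive zero    z zero    = toggle-involutive (z 0)
flipAt-involutive zero    z (suc i) = refl
flipAt-involutive (suc m) z zero    = refl
flipAt-involutive (suc m) z (suc i) = flipAt-involutive m (z ∘ suc) i

-- With two truth values, disagreeing with `Q` is agreeing with its negation.
¬⇔-¬ : {P Q : Set} → ¬ (P ⇔ Q) → ¬ (P ⇔ (¬ Q)) → ⊥
¬⇔-¬ ¬PQ ¬P¬Q = ¬¬-excluded-middle λ where
  (yes q) → ¬P¬Q (mk⇔ (λ p _ → ¬PQ (mk⇔ (λ _ → q) (λ _ → p))) (contradiction q))
  (no ¬q) → ¬PQ (mk⇔ (λ p → contradiction (mk⇔ (λ _ → ¬q) (λ _ → p)) ¬P¬Q)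
                     (λ q → contradiction q ¬q))

¬⇔-trans : {P Q R : Set} → ¬ (P ⇔ Q) → ¬ (Q ⇔ R) → ¬ ¬ (P ⇔ R)
¬⇔-trans ¬PQ ¬QR k = ¬⇔-¬ ¬PQ λ P⇔¬Q → ¬⇔-¬ (¬QR ∘ ⇔-sym) λ R⇔¬Q → k (⇔-sym R⇔¬Q ⇔-∘ P⇔¬Q)

twist-⁻¹ : ∀ B π y {P : Set} →
           ¬ (P ⇔ mem (twist π B) y) → ¬ (P ⇔ mem (twist (π ⁻¹) B) y) → ⊥
twist-⁻¹ B 0ℙ y ¬P¬y ¬Py = ¬⇔-¬ ¬P¬y ¬Py
twist-⁻¹ B 1ℙ y ¬P¬y ¬Py = ¬⇔-¬ ¬Py ¬P¬y

untwist : ∀ B π → mem (twist π B) x ⇔ mem (twist π B) y → mem B x ⇔ mem B y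
untwist B 0ℙ iff = iff
untwist B 1ℙ iff = mk⇔ (λ x∈B → Subset.mem-stable B _ λ y∉B → from iff y∉B x∈B)
                       (λ y∈B → Subset.mem-stable B _ λ x∉B → to iff x∉B y∈B)

BeatsTwists : Responses → Pred (ℕ → Subset) 0ℓ
BeatsTwists F A = ∀ n π → Beats (F n π) (A n) (twist π (A (suc n)))

limit-beats : ∀ {F} A → CausalResponses F → BeatsTwists F A → ∀ z →
              ¬ (mem (A 0) (limit F z) ⇔
                 mem (twist (parity (z 0)) (A 1)) (limit (F ∘ suc) (z ∘ suc)))
limit-beats A causal beats z iff =
  beats 0 (parity (z 0)) _ (iff ⇔-∘ ⇔-sym (mem-cong (A 0) (limit-unfold causal z)))

-- Induction on `m`. Flipping at 0 leaves the next point `x₁` unchanged but exchanges `A 1` with its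
-- complement, so the first point changes sides.
limit-flipAt : ∀ m {F} A → CausalResponses F → BeatsTwists F A → ∀ z →
               ¬ (mem (A 0) (limit F z) ⇔ mem (A 0) (limit F (flipAt m z)))
limit-flipAt zero {F} A causal beats z iff =
  twist-⁻¹ (A 1) (parity (z 0)) x₁ (limit-beats A causal beats z) λ h →
    subst (λ π → ¬ (mem (A 0) (limit F (flipAt 0 z)) ⇔ mem (twist π (A 1)) x₁))
      (parity-toggle (z 0))
      (limit-beats A causal beats (flipAt 0 z)) (h ⇔-∘ ⇔-sym iff)
  where
  x₁ = limit (F ∘ suc) (z ∘ suc)
-- Both sequences have the same parity at 0, so each limit disagrees with the same twist of `A 1`.
-- If the limits agreed, so would the next points, against the induction hypothesis.
limit-flipAt (suc m) A causal beats z iff = ¬⇔-trans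
  (limit-beats A causal beats z ∘ ⇔-sym)
  (λ h → limit-beats A causal beats (flipAt (suc m) z) (h ⇔-∘ ⇔-sym iff))
  (limit-flipAt m (A ∘ suc) (causal ∘ suc) (beats ∘ suc) (z ∘ suc) ∘ untwist (A 1) (parity (z 0)))

FlipSet : ∀ {F} → CausalResponses F → Subset → Subset
FlipSet {F} causal A = record
  { mem        = mem A ∘ limit F
  ; mem-resp   = Subset.mem-resp A ∘ limit-cong causal
  ; mem-stable = λ _ → Subset.mem-stable A _
  }

-- Baire category

cylinder-mono : m ≤ n → Cylinder x n y → Cylinder x m y
cylinder-mono m≤n x~y i i<m = x~y i (ℕₚ.<-≤-trans i<m m≤n)

cylinder-trans : Cylinder x n y → Cylinder y n z → Cylinder x n z
cylinder-trans x~y y~z i i<n = trans (x~y i i<n) (y~z i i<n)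

-- Nowhere density in combinatorial form. Arbitrary predicates are allowed because the unions below
-- need not be stable.
Avoidable : Pred (Pred ω^ω 0ℓ) 0ℓ
Avoidable P = ∀ x n → ∃ᶜ λ ((y , m) : ω^ω × ℕ) → n ≤ m × Cylinder x n y × Cylinder y m ⊆ ∁ P

-- Otherwise every point of the cylinder would lie in the closure of `N`. The length `n ⊔ i` keeps
-- the new cylinder inside the old one.
nowhereDense⇒avoidable : ∀ N → NowhereDense N → Avoidable (mem N)
nowhereDense⇒avoidable N nwd x n k = nwd x λ j → j (n , λ {y} x~y i h →
  k ( (y , n ⊔ i) , ℕₚ.m≤m⊔n n i , x~y
    , λ {w} y~w w∈N → h (w , cylinder-mono (ℕₚ.m≤n⊔m n i) y~w , w∈N) ))

avoidable-∪ : ∀ {P Q} → Avoidable P → Avoidable Q → Avoidable (P ∪ Q)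
avoidable-∪ avP avQ x n k =
  avP x n λ ((y , m) , n≤m , x~y , avoidsP) →
  avQ y m λ ((w , l) , m≤l , y~w , avoidsQ) →
  k ( (w , l) , ℕₚ.≤-trans n≤m m≤l , cylinder-trans {x} {n} {y} x~y (cylinder-mono n≤m y~w)
    , λ { w~v (inj₁ v∈P) → avoidsP (cylinder-trans {y} {m} {w} y~w (cylinder-mono m≤l w~v)) v∈P
        ; w~v (inj₂ v∈Q) → avoidsQ w~v v∈Q } )

avoidable-⋃ : ∀ {P : ℕ → Pred ω^ω 0ℓ} → (∀ n → Avoidable (P n)) →
              ∀ k → Avoidable (λ x → ∃ λ n → n < k × P n x)
avoidable-⋃ av zero    x n k = k ((x , n) , ℕₚ.≤-refl , (λ _ _ → refl) , λ _ ())
avoidable-⋃ {P} av (suc l) x n k =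
  avoidable-∪ (av l) (avoidable-⋃ {P} av l) x n λ (ym , n≤m , x~y , avoids) →
  k (ym , n≤m , x~y , λ y~z → λ where
    (i , i<1+l , z∈P) → case ℕₚ.m<1+n⇒m<n∨m≡n i<1+l of λ where
      (inj₁ i<l)  → avoids y~z (inj₂ (i , i<l , z∈P))
      (inj₂ refl) → avoids y~z (inj₁ z∈P))

avoidable-flipAt : ∀ {P} m → P Binary.Respects _≗_ → Avoidable P → Avoidable (flipAt m ⊢ P)
avoidable-flipAt m resp av x n k = av (flipAt m x) n λ ((y , l) , n≤l , x~y , avoids) →
  k ( (flipAt m y , l) , n≤l
    , cylinder-trans {x} {n} {flipAt m (flipAt m x)}
        (λ i _ → sym (flipAt-involutive m x i)) (flipAt-preserves-cylinder m x~y)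
    , λ {z} y~z z∈P → avoids
        (cylinder-trans {y} {l} {flipAt m (flipAt m y)}
          (λ i _ → sym (flipAt-involutive m y i)) (flipAt-preserves-cylinder m y~z)) z∈P )

cylinder-resp : ∀ {x x′ n n′ y y′} → x ≗ x′ → n ≡ n′ → y ≗ y′ → Cylinder x n y → Cylinder x′ n′ y′
cylinder-resp x≗x′ refl y≗y′ x~y i i<n = trans (sym (x≗x′ i)) (trans (x~y i i<n) (y≗y′ i))

cylinder-stable : ∀ x n → Stable (Cylinder x n)
cylinder-stable x n y h i i<n = decidable-stable (x i ℕₚ.≟ y i) λ ¬eq → h λ x~y → ¬eq (x~y i i<n)

module Baire (dc : DC-ℝ) {P : ℕ → Pred ω^ω 0ℓ}
             (av : ∀ n → Avoidable (P n)) (x : ω^ω) (l : ℕ) where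

  ⋃P : ℕ → Pred ω^ω 0ℓ
  ⋃P k y = ∃ λ n → n < k × P n y

  -- A state p of the dependent choice stands for the cylinder of length p 0
  -- around p ∘ suc.  As the first state is arbitrary, a state outside the given
  -- cylinder is moved into it in one step.

  record Refines (p q : ω^ω) : Set where
    field
      longer : p 0 < q 0
      within : Cylinder (p ∘ suc) (p 0) (q ∘ suc)
      avoids : Cylinder (q ∘ suc) (q 0) ⊆ ∁ (⋃P (p 0))

  open Refines

  R : Rel ω^ω 0ℓ
  R p q = Cylinder x l (q ∘ suc) × (Cylinder x l (p ∘ suc) → Refines p q)

  refines-resp : ∀ {p p′ q q′} → p ≗ p′ → q ≗ q′ → Refines p q → Refines p′ q′
  refines-resp {p} {p′} {q} {q′} p≗p′ q≗q′ ref = record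
    { longer = subst₂ _<_ (p≗p′ 0) (q≗q′ 0) (longer ref)
    ; within = cylinder-resp {p ∘ suc} (p≗p′ ∘ suc) (p≗p′ 0) (q≗q′ ∘ suc) (within ref)
    ; avoids = λ q~y → subst (λ k → ∁ (⋃P k) _) (p≗p′ 0)
        (avoids ref (cylinder-resp {q′ ∘ suc} (sym ∘ q≗q′ ∘ suc) (sym (q≗q′ 0)) (λ _ → refl) q~y))
    }

  R-resp : R Binary.Respects₂ _≗_
  R-resp =
      (λ q≗q′ (x~q , ref) →
         cylinder-resp {x} (λ _ → refl) refl (q≗q′ ∘ suc) x~q ,
         refines-resp (λ _ → refl) q≗q′ ∘ ref)
    , (λ p≗p′ (x~q , ref) →
         x~q ,
         refines-resp p≗p′ (λ _ → refl) ∘ ref ∘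
         cylinder-resp {x} (λ _ → refl) refl (sym ∘ p≗p′ ∘ suc))

  R-stable : Binary.Stable R
  R-stable p q h =
      cylinder-stable x l (q ∘ suc) (λ k → h (k ∘ proj₁))
    , λ x~p → record
        { longer = decidable-stable (p 0 ℕₚ.<? q 0) (λ k → h λ (_ , ref) → k (longer (ref x~p)))
        ; within = cylinder-stable (p ∘ suc) (p 0) (q ∘ suc)
                     (λ k → h λ (_ , ref) → k (within (ref x~p)))
        ; avoids = λ q~y y∈P → h λ (_ , ref) → avoids (ref x~p) q~y y∈P
        }

  R-total : ∀ p → ∃ᶜ (R p)
  R-total p k = ¬¬-excluded-middle λ where
    -- Length 0 is allowed here, since `R` asks for refinement only from states inside the cylinder.
    (no x≁p)  → k (0 ◂ x , (λ _ _ → refl) , λ x~p → contradiction x~p x≁p)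
    (yes x~p) →
      -- The bound `l` keeps the new centre in the given cylinder, and `suc (p 0)` makes the length
      -- grow strictly.
      avoidable-⋃ {P} av (p 0) (p ∘ suc) (l ⊔ suc (p 0)) λ ((y , m) , ≤m , p~y , avoidsP) →
      k ( m ◂ y
        , cylinder-trans {x} {l} {p ∘ suc} x~p (cylinder-mono (ℕₚ.m≤m⊔n l _) p~y)
        , λ _ → record
            { longer = ℕₚ.≤-trans (ℕₚ.m≤n⊔m l _) ≤m
            ; within = cylinder-mono (ℕₚ.≤-trans (ℕₚ.n≤1+n _) (ℕₚ.m≤n⊔m l _)) p~y
            ; avoids = avoidsP
            } )

  module _ {s : ℕ → ω^ω} (refines : ∀ n → Refines (s n) (s (suc n))) where

    -- Digit `i` is taken from the centre of state `suc i`, whose length is at least `suc i`, so it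
    -- is final.
    diagonal : ω^ω
    diagonal i = s (suc i) (suc i)

    n≤length : ∀ n → n ≤ s n 0
    n≤length zero    = z≤n
    n≤length (suc n) = ℕₚ.≤-<-trans (n≤length n) (longer (refines n))

    refines-+ : ∀ j n → s n 0 ≤ s (j + n) 0 × Cylinder (s n ∘ suc) (s n 0) (s (j + n) ∘ suc)
    refines-+ zero    n = ℕₚ.≤-refl , λ _ _ → refl
    refines-+ (suc j) n =
      let (≤ⱼ , ~ⱼ) = refines-+ j n
      in ℕₚ.≤-trans ≤ⱼ (ℕₚ.<⇒≤ (longer (refines (j + n))))
       , cylinder-trans {s n ∘ suc} {s n 0} {s (j + n) ∘ suc} ~ⱼ
           (cylinder-mono ≤ⱼ (within (refines (j + n))))

    refines-≤ : m ≤ n → Cylinder (s m ∘ suc) (s m 0) (s n ∘ suc)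
    refines-≤ {m} {n} m≤n = subst (λ k → Cylinder (s m ∘ suc) (s m 0) (s k ∘ suc)) (ℕₚ.m∸n+n≡m m≤n)
                                  (proj₂ (refines-+ (n ∸ m) m))

    cylinder-diagonal : ∀ n → Cylinder (s n ∘ suc) (s n 0) diagonal
    cylinder-diagonal n i i<sₙ with ℕₚ.≤-total n (suc i)
    ... | inj₁ n≤1+i = refines-≤ n≤1+i i i<sₙ
    ... | inj₂ 1+i≤n = sym (refines-≤ 1+i≤n i (n≤length (suc i)))

    diagonal-avoids : ∀ n → ¬ P n diagonal
    -- State `suc n` has length above `n`, so the step out of it is the one certain to avoid `P n`.
    diagonal-avoids n d∈P = avoids (refines (suc n)) (cylinder-diagonal (suc (suc n)))
                                               (n , n≤length (suc n) , d∈P)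

  -- The Baire category theorem inside a cylinder.
  generic : ∃ᶜ λ z → Cylinder x l z × (∀ n → ¬ P n z)
  generic k = dc R R-resp R-stable R-total λ (s , s-R) →
    -- Only the first state can lie outside the cylinder, so refinement holds from `s 1` on and
    -- `s 0` is dropped.
    let inside n  = proj₁ (s-R n)
        refines n = proj₂ (s-R (suc n)) (inside n)
    in k ( diagonal refines
         , (λ i → inside (suc i) i)
         , diagonal-avoids refines )

¬BP : DC-ℝ → ∀ {F} A → CausalResponses F → BeatsTwists F A → ¬ BP
¬BP dc {F} A causal beats bp =
  bp S λ (U , openU , meagre) → meagre λ (N , nwd , covers) →
  let
    -- Avoiding these unions makes both `z` and `flipAt l z` avoid every `N n`.
    N∪N′ : ℕ → ℕ → Pred ω^ω 0ℓ
    N∪N′ l n = mem (N n) ∪ (flipAt l ⊢ mem (N n))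

    av : ∀ l n → Avoidable (N∪N′ l n)
    av l n = let avN = nowhereDense⇒avoidable (N n) (nwd n) in
             avoidable-∪ avN (avoidable-flipAt l (Subset.mem-resp (N n)) avN)

    U⊆S : ∀ {w} → (∀ n → ¬ mem (N n) w) → mem U w → mem S w
    U⊆S {w} w∉N w∈U = Subset.mem-stable S w λ w∉S →
      covers (inj₂ (w∈U , w∉S)) λ (n , w∈N) → w∉N n w∈N

    S⊆U : ∀ {w} → (∀ n → ¬ mem (N n) w) → mem S w → mem U w
    S⊆U {w} w∉N w∈S = Subset.mem-stable U w λ w∉U →
      covers (inj₁ (w∈S , w∉U)) λ (n , w∈N) → w∉N n w∈N

    -- A cylinder of length `l` inside `U` contains `flipAt l z` along with `z`; for generic `z`
    -- both lie in `S`, against `limit-flipAt`.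
    U-empty : ∀ x → ¬ mem U x
    U-empty x x∈U = openU x∈U λ (l , cylinder⊆U) →
      Baire.generic dc (av l) x l λ (z , x~z , avoids) →
      let z∈U  = cylinder⊆U x~z
          z′∈U = cylinder⊆U (cylinder-trans {x} {l} {z} x~z (flipAt-cylinder l z))
      in limit-flipAt l A causal beats z
           (mk⇔ (λ _ → U⊆S (λ n → avoids n ∘ inj₂) z′∈U) (λ _ → U⊆S (λ n → avoids n ∘ inj₁) z∈U))
  -- With `U` empty, a generic `z` and its flip both lie outside `S`, again against `limit-flipAt`.
  in Baire.generic dc (av 0) (λ _ → 0) 0 λ (z , _ , avoids) →
     limit-flipAt 0 A causal beats z
       (mk⇔ (λ z∈S → contradiction (S⊆U (λ n → avoids n ∘ inj₁) z∈S) (U-empty _))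
            (λ z′∈S → contradiction (S⊆U (λ n → avoids n ∘ inj₂) z′∈S) (U-empty _)))
  where
  S : Subset
  S = FlipSet causal (A 0)

corollary4p9 : DC-ℝ → AD-L →
    ((A B : Subset) → (A <ᶜ B) ⇔ (A <ᴸ B)) ×
    (BP → WellFoundedPreorder _≤ᶜ_)
corollary4p9 dc ad =
    (λ A B → mk⇔ (<ᶜ⇒<ᴸ {A} {B}) (<ᴸ⇒<ᶜ {A} {B} ad))
  , λ bp (A , desc) →
      chooseResponses dc ad A (λ n → <ᶜ⇒<ᴸ {A (suc n)} {A n} (desc n)) λ ((ℓ , F) , good) →
        ¬BP dc (A ∘ ℓ) (λ n π → proj₁ (good n π)) (λ n π → proj₂ (good n π)) bp
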